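{- $\mathrm{DNS} \vdash_i^{\mathfrak{e}\mathfrak{f}} \Delta^{\mathfrak{f}}$; that is, in intuitionistic higher-order logic with equality and functional extensionality, the double-negation shift implies the weak functional extensionality principle $\forall f\,\forall g.\,(\forall x.\,\neg\neg(f\,x=g\,x))\Rightarrow\neg\neg(f=g)$ (for $f,g$ of any type $\tau\to\sigma$ and $x$ of type $\tau$).
   Context: Syntax. Simple types are generated by: $\iota$ (individuals), $o$ (propositions), and $\tau \to \sigma$ for types $\tau,\sigma$. For each type $\tau$ there are a set $\mathcal{V}_\tau$ of variables (infinitely many, as usual) and a set $\mathcal{C}_\tau$ of constants; variables and constants are disjoint. Terms are simply typed: variables and constants of type $\tau$ are terms of type $\tau$; if $x\in\mathcal{V}_\tau$ and $t$ has type $\sigma$, then $\lambda x.t$ has type $\tau\to\sigma$; if $t$ has type $\tau\to\sigma$ and $u$ has type $\tau$, then $t\,u$ has type $\sigma$. Terms are taken up to renaming of bound variables; $t[x\leftarrow u]$ is capture-avoiding substitution; $\equiv_\beta$ is the congruence generated by $(\lambda x.t)u \hookrightarrow t[x\leftarrow u]$ (no $\eta$). Formulas are terms of type $o$. The constants include $\top,\bot$ of type $o$; $\neg$ of type $o\to o$; $\Rightarrow,\wedge,\vee$ of type $o\to o\to o$; and for every type $\tau$, $\forall_\tau,\exists_\tau$ of type $(\tau\to o)\to o$ and $=_\tau$ of type $\tau\to\tau\to o$ (written infix); there may be further constants. $\forall x.A$ and $\exists x.A$ abbreviate $\forall_\tau(\lambda x.A)$, $\exists_\tau(\lambda x.A)$.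 $FV$ denotes free variables. A context is a finite sequence of formulas. Derivability. Intuitionistic logic has the usual natural deduction rules: introduction and elimination for $\Rightarrow,\wedge,\vee$; Not-I: from $\Gamma,A\vdash\bot$ infer $\Gamma\vdash\neg A$; Not-E: from $\Gamma\vdash\neg A$ and $\Gamma\vdash A$ infer $\Gamma\vdash\bot$; Bot-E: from $\Gamma\vdash\bot$ infer $\Gamma\vdash A$; Top-I: $\Gamma\vdash\top$; All-I: from $\Gamma\vdash P\,x$ with $x\notin FV(\Gamma,P)$ infer $\Gamma\vdash\forall P$; All-E: from $\Gamma\vdash\forall P$ infer $\Gamma\vdash P\,t$; Ex-I: from $\Gamma\vdash P\,t$ infer $\Gamma\vdash\exists P$; Ex-E: from $\Gamma\vdash\exists P$ and $\Gamma,P\,x\vdash A$ with $x\notin FV(\Gamma,P,A)$ infer $\Gamma\vdash A$; Ax: $\Gamma,A,\Delta\vdash A$; Conv: from $\Gamma\vdash A$ and $A\equiv_\beta B$ infer $\Gamma\vdash B$. Equality rules. Eq-I: $\Gamma\vdash u=u$. Eq-E: from $\Gamma\vdash P\,u$ and $\Gamma\vdash u=v$ infer $\Gamma\vdash P\,v$. FunExt: from $\Gamma\vdash f\,x=g\,x$ with $x\notin FV(\Gamma,f,g)$ infer $\Gamma\vdash f=g$. $\Gamma\vdash_i^{\mathfrak{e}\mathfrak{f}} A$ means that $\Gamma\vdash A$ is derivable in intuitionistic logic with the additional rules Eq-I, Eq-E and FunExt. $\mathrm{DNS}$ (double-negation shift) is the principle $(\forall x.\,\neg\neg A)\Rightarrow(\neg\neg\forall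 x.\,A)$, for every formula $A$ and every variable $x$ of any type; as hypotheses, its instances are taken universally closed, and finitely many of them may be used in a derivation. $\Delta^{\mathfrak{f}}$ is $\forall f\,\forall g.\,(\forall x.\,\neg\neg(f\,x=g\,x))\Rightarrow\neg\neg(f=g)$ for $f,g$ of type $\tau\to\sigma$ and $x$ of type $\tau$, for all types $\tau,\sigma$; the claim asserts derivability of each of these type instances. -}

module Defs where

open import Data.List using (List; []; _∷_; _++_; [_])
open import Data.List.Membership.Propositional using (_∈_; _∉_)
open import Data.List.Relation.Unary.All using (All)
open import Data.List.Relation.Unary.Any using (here; there)
open import Data.Nat using (ℕ)
open import Data.Product using (Σ; ∃-syntax; _×_; _,_)
open import Function using (_↣_)
open import Relation.Binary.PropositionalEquality using (_≡_; refl)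

infixr 20 _⟶_

data Type : Set where
  ι o : Type
  _⟶_ : Type → Type → Type

record Language : Set₁ where
  field
    Var         : Type → Set
    infinite    : ∀ τ → ℕ ↣ Var τ
    -- The constants other than the logical ones and equality.
    ExtraConst  : Type → Set

module Logic (L : Language) where
  open Language L public

  data Const : Type → Set where
    ⊤ᶜ ⊥ᶜ       : Const o
    ¬ᶜ          : Const (o ⟶ o)
    ⇒ᶜ ∧ᶜ ∨ᶜ    : Const (o ⟶ o ⟶ o)
    ∀ᶜ ∃ᶜ       : ∀ τ → Const ((τ ⟶ o) ⟶ o)
    =ᶜ          : ∀ τ → Const (τ ⟶ τ ⟶ o)
    extra       : ∀ {τ} → ExtraConst τ → Const τ

  -- Terms up to renaming of bound variables: bound variables are typed
  -- de Bruijn indices into Ξ, free variables are named elements of Var.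
  -- The terms of the object language are those with Ξ = [].
  data Term (Ξ : List Type) : Type → Set where
    bvar : ∀ {τ} → τ ∈ Ξ → Term Ξ τ
    fvar : ∀ {τ} → Var τ → Term Ξ τ
    con  : ∀ {τ} → Const τ → Term Ξ τ
    lam  : ∀ {τ σ} → Term (τ ∷ Ξ) σ → Term Ξ (τ ⟶ σ)
    _·_  : ∀ {τ σ} → Term Ξ (τ ⟶ σ) → Term Ξ τ → Term Ξ σ

  infixl 15 _·_

  Formula : Set
  Formula = Term [] o

  Context : Set
  Context = List Formula

  FV : ∀ {Ξ τ} → Term Ξ τ → List (Σ Type Var)
  FV (bvar i)     = []
  FV (fvar {τ} x) = [ τ , x ]
  FV (con c)      = []
  FV (lam t)      = FV t
  FV (t · u)      = FV t ++ FV u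

  infix 4 _#_

  _#_ : ∀ {Ξ τ σ} → Var τ → Term Ξ σ → Set
  _#_ {τ = τ} x t = (τ , x) ∉ FV t

  Closed : ∀ {Ξ τ} → Term Ξ τ → Set
  Closed t = FV t ≡ []

  Ren : List Type → List Type → Set
  Ren Ξ Θ = ∀ {τ} → τ ∈ Ξ → τ ∈ Θ

  liftRen : ∀ {Ξ Θ σ} → Ren Ξ Θ → Ren (σ ∷ Ξ) (σ ∷ Θ)
  liftRen ρ (here p)  = here p
  liftRen ρ (there i) = there (ρ i)

  rename : ∀ {Ξ Θ τ} → Ren Ξ Θ → Term Ξ τ → Term Θ τ
  rename ρ (bvar i) = bvar (ρ i)
  rename ρ (fvar x) = fvar x
  rename ρ (con c)  = con c
  rename ρ (lam t)  = lam (rename (liftRen ρ) t)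
  rename ρ (t · u)  = rename ρ t · rename ρ u

  Sub : List Type → List Type → Set
  Sub Ξ Θ = ∀ {τ} → τ ∈ Ξ → Term Θ τ

  liftSub : ∀ {Ξ Θ σ} → Sub Ξ Θ → Sub (σ ∷ Ξ) (σ ∷ Θ)
  liftSub s (here p)  = bvar (here p)
  liftSub s (there i) = rename there (s i)

  subst : ∀ {Ξ Θ τ} → Sub Ξ Θ → Term Ξ τ → Term Θ τ
  subst s (bvar i) = s i
  subst s (fvar x) = fvar x
  subst s (con c)  = con c
  subst s (lam t)  = lam (subst (liftSub s) t)
  subst s (t · u)  = subst s t · subst s u

  single : ∀ {Ξ σ} → Term Ξ σ → Sub (σ ∷ Ξ) Ξ
  single u (here refl) = u
  single u (there i)   = bvar i

  infixl 30 _[_]₀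

  _[_]₀ : ∀ {Ξ σ τ} → Term (σ ∷ Ξ) τ → Term Ξ σ → Term Ξ τ
  t [ u ]₀ = subst (single u) t

  infix 4 _≡β_

  data _≡β_ {Ξ : List Type} : ∀ {τ} → Term Ξ τ → Term Ξ τ → Set where
    β       : ∀ {τ σ} (t : Term (τ ∷ Ξ) σ) (u : Term Ξ τ) → lam t · u ≡β t [ u ]₀
    β-refl  : ∀ {τ} {t : Term Ξ τ} → t ≡β t
    β-sym   : ∀ {τ} {t u : Term Ξ τ} → t ≡β u → u ≡β t
    β-trans : ∀ {τ} {t u v : Term Ξ τ} → t ≡β u → u ≡β v → t ≡β v
    β-lam   : ∀ {τ σ} {t u : Term (τ ∷ Ξ) σ} → t ≡β u → lam t ≡β lam u
    β-app   : ∀ {τ σ} {t t′ : Term Ξ (τ ⟶ σ)} {u u′ : Term Ξ τ} →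
              t ≡β t′ → u ≡β u′ → t · u ≡β t′ · u′

  infix  14 _≐_
  infix  13 ¬̇_
  infixr 12 _∧̇_
  infixr 11 _∨̇_
  infixr 10 _⇒_

  ⊤̇ ⊥̇ : ∀ {Ξ} → Term Ξ o
  ⊤̇ = con ⊤ᶜ
  ⊥̇ = con ⊥ᶜ

  ¬̇_ : ∀ {Ξ} → Term Ξ o → Term Ξ o
  ¬̇ A = con ¬ᶜ · A

  _⇒_ _∧̇_ _∨̇_ : ∀ {Ξ} → Term Ξ o → Term Ξ o → Term Ξ o
  A ⇒ B = con ⇒ᶜ · A · B
  A ∧̇ B = con ∧ᶜ · A · B
  A ∨̇ B = con ∨ᶜ · A · B

  _≐_ : ∀ {Ξ τ} → Term Ξ τ → Term Ξ τ → Term Ξ o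
  _≐_ {τ = τ} t u = con (=ᶜ τ) · t · u

  Forall Exists : ∀ {Ξ τ} → Term Ξ (τ ⟶ o) → Term Ξ o
  Forall {τ = τ} P = con (∀ᶜ τ) · P
  Exists {τ = τ} P = con (∃ᶜ τ) · P

  ∀̇ : ∀ {Ξ} τ → Term (τ ∷ Ξ) o → Term Ξ o
  ∀̇ τ A = Forall (lam A)

  infix 3 _⊢_

  -- Γ , A is written A ∷ Γ.
  data _⊢_ (Γ : Context) : Formula → Set where
    Ax     : ∀ {A} → A ∈ Γ → Γ ⊢ A
    Conv   : ∀ {A B} → Γ ⊢ A → A ≡β B → Γ ⊢ B
    Top-I  : Γ ⊢ ⊤̇
    Bot-E  : ∀ {A} → Γ ⊢ ⊥̇ → Γ ⊢ A
    Not-I  : ∀ {A} → A ∷ Γ ⊢ ⊥̇ → Γ ⊢ ¬̇ A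
    Not-E  : ∀ {A} → Γ ⊢ ¬̇ A → Γ ⊢ A → Γ ⊢ ⊥̇
    Imp-I  : ∀ {A B} → A ∷ Γ ⊢ B → Γ ⊢ A ⇒ B
    Imp-E  : ∀ {A B} → Γ ⊢ A ⇒ B → Γ ⊢ A → Γ ⊢ B
    And-I  : ∀ {A B} → Γ ⊢ A → Γ ⊢ B → Γ ⊢ A ∧̇ B
    And-E₁ : ∀ {A B} → Γ ⊢ A ∧̇ B → Γ ⊢ A
    And-E₂ : ∀ {A B} → Γ ⊢ A ∧̇ B → Γ ⊢ B
    Or-I₁  : ∀ {A B} → Γ ⊢ A → Γ ⊢ A ∨̇ B
    Or-I₂  : ∀ {A B} → Γ ⊢ B → Γ ⊢ A ∨̇ B
    Or-E   : ∀ {A B C} → Γ ⊢ A ∨̇ B → A ∷ Γ ⊢ C → B ∷ Γ ⊢ C → Γ ⊢ C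
    All-I  : ∀ {τ} {P : Term [] (τ ⟶ o)} (x : Var τ) →
             All (x #_) Γ → x # P → Γ ⊢ P · fvar x → Γ ⊢ Forall P
    All-E  : ∀ {τ} {P : Term [] (τ ⟶ o)} (t : Term [] τ) → Γ ⊢ Forall P → Γ ⊢ P · t
    Ex-I   : ∀ {τ} {P : Term [] (τ ⟶ o)} (t : Term [] τ) → Γ ⊢ P · t → Γ ⊢ Exists P
    Ex-E   : ∀ {τ A} {P : Term [] (τ ⟶ o)} (x : Var τ) →
             All (x #_) Γ → x # P → x # A → Γ ⊢ Exists P → (P · fvar x) ∷ Γ ⊢ A → Γ ⊢ A
    Eq-I   : ∀ {τ} {u : Term [] τ} → Γ ⊢ u ≐ u
    Eq-E   : ∀ {τ} {u v : Term [] τ} (P : Term [] (τ ⟶ o)) →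
             Γ ⊢ P · u → Γ ⊢ u ≐ v → Γ ⊢ P · v
    FunExt : ∀ {τ σ} {f g : Term [] (τ ⟶ σ)} (x : Var τ) →
             All (x #_) Γ → x # f → x # g → Γ ⊢ f · fvar x ≐ g · fvar x → Γ ⊢ f ≐ g

  infix 3 _⊢ᵢᵉᶠ_

  -- Derivability from a possibly infinite set of hypotheses.
  _⊢ᵢᵉᶠ_ : (Formula → Set) → Formula → Set
  T ⊢ᵢᵉᶠ A = ∃[ Γ ] All T Γ × Γ ⊢ A

  closure : ∀ Ξ → Term Ξ o → Formula
  closure []      A = A
  closure (τ ∷ Ξ) A = closure Ξ (∀̇ τ A)

  -- The universally closed instances.  The variables to be quantified are the
  -- indices in Ξ; Closed A says that none has been left unquantified.
  data DNS : Formula → Set where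
    dns : ∀ Ξ τ (A : Term (τ ∷ Ξ) o) → Closed A →
          DNS (closure Ξ (∀̇ τ (¬̇ ¬̇ A) ⇒ ¬̇ ¬̇ ∀̇ τ A))

  Δᶠ : Type → Type → Formula
  Δᶠ τ σ =
    ∀̇ (τ ⟶ σ) (∀̇ (τ ⟶ σ)
      (∀̇ τ (¬̇ ¬̇ (bvar 2nd · bvar 0th ≐ bvar 1st · bvar 0th))
        ⇒ ¬̇ ¬̇ (bvar 1st ≐ bvar 0th)))
    where
    0th : ∀ {ρ Ξ} → ρ ∈ ρ ∷ Ξ
    0th = here refl
    1st : ∀ {ρ ρ₁ Ξ} → ρ ∈ ρ₁ ∷ ρ ∷ Ξ
    1st = there 0th
    2nd : ∀ {ρ ρ₁ ρ₂ Ξ} → ρ ∈ ρ₁ ∷ ρ₂ ∷ ρ ∷ Ξ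
    2nd = there 1st

{-# OPTIONS --safe #-}
module Submission where

-- DNS for the formula f x = g x turns ∀x. ¬¬(f x = g x) into ¬¬∀x. f x = g x,
-- and functional extensionality applies under the double negation.

open import Data.List using ([]; _∷_)
open import Data.List.Membership.Propositional using (_∉_)
open import Data.List.Relation.Unary.All using (All; []; _∷_)
open import Data.List.Relation.Unary.Any using (here; there)
open import Data.Product using (Σ; _,_)
open import Function using (Injection)
open import Relation.Binary.PropositionalEquality using (_≢_; refl)

open import Defs

-- A single instance of DNS, closed over f and g, is the only hypothesis. `FunExt` yields f = g from
-- ∀x. f x = g x, so a refutation of f = g refutes ∀x. f x = g x, contradicting the conclusion of
-- the instance. The rest is eigenvariable freshness and β-conversion.

-- Types are finite trees, so `τ` is never `τ ⟶ σ`: the types alone separate x from f and g.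
argument-fresh : ∀ {V : Type → Set} {τ σ} {x : V τ} {f g : V (τ ⟶ σ)} →
                 _∉_ {A = Σ Type V} (τ , x) ((τ ⟶ σ , f) ∷ (τ ⟶ σ , g) ∷ [])
argument-fresh (here ())
argument-fresh (there (here ()))

-- For generalizing over g: the formula under that quantifier contains f twice, and f has the same
-- type as g.
distinct-fresh : ∀ {V : Type → Set} {τ} {f g : V τ} → g ≢ f →
                 _∉_ {A = Σ Type V} (τ , g) ((τ , f) ∷ (τ , f) ∷ [])
distinct-fresh g≢f (here refl)         = g≢f refl
distinct-fresh g≢f (there (here refl)) = g≢f refl

proposition4 : (L : Language) → let open Logic L in (τ σ : Type) → DNS ⊢ᵢᵉᶠ Δᶠ τ σ
proposition4 L τ σ =
  -- The index of x is 0, of g is 1, of f is 2; `closure` binds the last outermost, so f is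
  -- instantiated before g.
  _ ∷ [] , dns ((τ ⟶ σ) ∷ (τ ⟶ σ) ∷ []) τ
             (bvar (there (there (here refl))) · bvar (here refl)
               ≐ bvar (there (here refl)) · bvar (here refl))
             refl ∷ [] ,
  ∀-intro f ((λ ()) ∷ []) (λ ())
    (∀-intro g ((λ ()) ∷ []) (distinct-fresh g≢f)
      (Imp-I (Not-I (Not-E
        (Imp-E (∀-elim (fvar g) (∀-elim (fvar f) (Ax (there (there (here refl))))))
               (Ax (there (here refl))))
        -- Here ∀x. f x = g x is assumed, to be refuted by the hypothesis ¬(f = g).
        (Not-I (Not-E (Ax (there (here refl)))
          (FunExt x
            (argument-fresh ∷ argument-fresh ∷ argument-fresh ∷ (λ ()) ∷ [])
            (λ { (here ()) }) (λ { (here ()) })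
            (∀-elim (fvar x) (Ax (here refl))))))))))
  where
  open Logic L

  -- The quantifier rules speak of `P · t`; for `P` an abstraction this is a β-redex, contracted
  -- here by `Conv`.
  ∀-intro : ∀ {Γ ρ} {A : Term (ρ ∷ []) o} (y : Var ρ) → All (y #_) Γ → y # A →
            Γ ⊢ A [ fvar y ]₀ → Γ ⊢ ∀̇ ρ A
  ∀-intro y y#Γ y#A d = All-I y y#Γ y#A (Conv d (β-sym (β _ _)))

  ∀-elim : ∀ {Γ ρ} {A : Term (ρ ∷ []) o} (t : Term [] ρ) → Γ ⊢ ∀̇ ρ A → Γ ⊢ A [ t ]₀
  ∀-elim t d = Conv (All-E t d) (β _ _)

  f g : Var (τ ⟶ σ)
  f = Injection.to (infinite (τ ⟶ σ)) 0
  g = Injection.to (infinite (τ ⟶ σ)) 1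

  x : Var τ
  x = Injection.to (infinite τ) 0

  g≢f : g ≢ f
  g≢f g≡f with Injection.injective (infinite (τ ⟶ σ)) g≡f
  ... | ()
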